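{- Let $n\ge 1$ be an integer and let $C_n=n2^n+1$. If $\phi(C_n)\mid C_n-1$, where $\phi$ denotes Euler's totient function, then $C_n$ is prime.
   Context: $C_n=n2^n+1$ is called the $n$th Cullen number. -}

module Defs where

open import Data.List.Base using (applyUpTo; filter; length)
open import Data.Nat.Base using (ℕ; suc; _+_; _*_; _^_)
open import Data.Nat.Coprimality using (coprime?)

-- Euler's totient: the number of k with 1 ≤ k ≤ m and gcd(k, m) = 1
-- (applyUpTo suc m is the list 1, 2, …, m).
φ : ℕ → ℕ
φ m = length (filter (λ k → coprime? k m) (applyUpTo suc m))

cullen : ℕ → ℕ
cullen n = n * 2 ^ n + 1

{-# OPTIONS --safe #-}

-- Put M = n 2^n and C = M + 1, and suppose that C is composite. Since φ(C) ∣ M, C is squarefree and the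
-- product of the p - 1 over the primes p ∣ C divides n 2^n, so that p = m 2^t + 1 where t ≤ n and the
-- product of the cofactors m divides n. Put D = p - 1. Modulo p both M and D are -1, so dividing n by t
-- with remainder yields a multiplicative relation with small coefficients between M and D. If t is large
-- in terms of m, it can hold modulo p only as an identity D^k = M with k odd. At most one prime is of
-- that kind, and then D^3 ≤ M. The other primes are at most 2^O(log n) if m = 1, and at most m^O(√n) if
-- m ≥ 2. Hence C is at most about M^(1/3) n^O(√n + log n), which is impossible for n ≥ 1024. For n < 1024
-- all numbers m 2^t + 1 dividing C are enumerated.

module Submission where

open import Defs
open import Data.Bool.Base using (Bool; true; _∧_)
open import Data.Bool.Properties using (T-≡; ∧-conicalˡ; ∧-conicalʳ)
open import Data.List.Base using (List; []; _∷_; _++_; map; filter; length; applyUpTo; concatMap; deduplicate)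
open import Data.List.Properties using (filter-++; length-++; filter-none; filter-accept; length-applyUpTo)
open import Data.List.Membership.Propositional.Properties using
  (∈-∃++; ∈-applyUpTo⁺; ∈-filter⁺; ∈-filter⁻; ∈-concatMap⁺; ∈-concatMap⁻; ∈-deduplicate⁺; ∈-deduplicate⁻)
open import Data.List.Relation.Binary.Permutation.Propositional.Properties using (shift; All-resp-↭; ∈-resp-↭)
open import Data.List.Relation.Binary.Pointwise.Base as Pointwise using (Pointwise; []; _∷_)
open import Data.List.Relation.Unary.All as All using (All; []; _∷_)
open import Data.List.Relation.Unary.All.Properties using (applyUpTo⁺₁)
open import Data.List.Relation.Unary.Any as Any using (here; there)
open import Data.List.Relation.Unary.Unique.Propositional using (Unique; []; _∷_)
open import Data.List.Relation.Unary.Unique.Propositional.Properties using (filter⁺)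
open import Data.Nat.Base
open import Data.Nat.Coprimality using (Coprime; coprime?; GCD≡1⇒coprime; coprime-divisor)
open import Data.Nat.Divisibility
open import Data.Nat.DivMod using (m≡m%n+[m/n]*n; m%n<n; m/n*n≤m)
open import Data.Nat.GCD using (GCD; gcd; gcd-GCD; gcd[m,n]∣m; gcd[m,n]∣n; GCD-*)
open import Data.Nat.ListAction using (product)
open import Data.Nat.ListAction.Properties using (∈⇒∣product; product-↭)
open import Data.Nat.Primality using
  (Prime; prime?; prime[2]; prime⇒irreducible; prime⇒nonZero; ¬prime[0]; ¬prime[1])
open import Data.Nat.Primality.Factorisation using (PrimeFactorisation; factorise)
open import Data.Nat.Properties
open import Data.List.Membership.DecPropositional _≟_ using (_∈_; _∈?_)
open import Data.Nat.Tactic.RingSolver using (solve-∀)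
open import Data.Product.Base using (_×_; _,_; ∃-syntax; ∃₂; proj₁; proj₂)
open import Data.Sum.Base using (_⊎_; inj₁; inj₂)
open import Function.Base using (_∘_; it)
open import Function.Bundles using (Equivalence)
open import Level using (Level)
open import Relation.Binary.PropositionalEquality
open import Relation.Nullary using (¬_; yes; no; contradiction)
open import Relation.Unary using (Pred; Decidable)

-- Parity of exponents and powers of D modulo D + 1

Odd : ℕ → Set
Odd k = ∃[ j ] k ≡ suc (2 * j)

Even : ℕ → Set
Even k = ∃[ j ] k ≡ 2 * j

even⊎odd : ∀ k → Even k ⊎ Odd k
even⊎odd zero = inj₁ (0 , refl)
even⊎odd (suc k) with even⊎odd k
... | inj₁ (j , refl) = inj₂ (j , refl)
... | inj₂ (j , refl) = inj₁ (suc j , sym (*-suc 2 j))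

-- Modulo D + 1 even powers of D are 1 ≡ -D and odd powers are -1. Both congruences are put as sums
-- to avoid subtraction, and each follows from the other by one multiplication by D.
1+D∣D^even+D : ∀ D j → suc D ∣ D ^ (2 * j) + D
1+D∣D^odd+1 : ∀ D j → suc D ∣ D ^ suc (2 * j) + 1

1+D∣D^even+D D zero = ∣-refl
1+D∣D^even+D D (suc j) = subst (suc D ∣_) (begin
    D * (D ^ suc (2 * j) + 1)  ≡⟨ *-distribˡ-+ D _ 1 ⟩
    D * D ^ suc (2 * j) + D * 1 ≡⟨ cong₂ (λ k x → D ^ k + x) (sym (*-suc 2 j)) (*-identityʳ D) ⟩
    D ^ (2 * suc j) + D ∎)
  (∣n⇒∣m*n D (1+D∣D^odd+1 D j))
  where
  open ≡-Reasoning

1+D∣D^odd+1 D j = ∣m+n∣m⇒∣n (subst (suc D ∣_) (lem D (D ^ (2 * j)))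
    (∣m∣n⇒∣m+n (∣n⇒∣m*n D (1+D∣D^even+D D j)) ∣-refl)) (n∣m*n D)
  where
  lem : ∀ D x → D * (x + D) + suc D ≡ D * suc D + (D * x + 1)
  lem = solve-∀

-- Modulo D + 1 we have M ≡ D ≡ -1, so X M = Y D ^ k gives X ≡ ± Y.
small-relation⇒power : ∀ {D M X Y} k .{{_ : NonZero X}} → suc D ∣ suc M →
  X * M ≡ Y * D ^ k → X + Y ≤ D → Odd k × D ^ k ≡ M
small-relation⇒power {D} {M} {X} {Y} k p∣N eq X+Y≤D with even⊎odd k
-- For even `k` the relation reads -X ≡ Y, so D + 1 divides X + Y, although 0 < X + Y ≤ D.
... | inj₁ (j , refl) = contradiction (∣⇒≤ {{X+Y≢0}} p∣X+Y) (<⇒≱ (s≤s X+Y≤D))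
  where
  X+Y≢0 : NonZero (X + Y)
  X+Y≢0 = >-nonZero (≤-trans (>-nonZero⁻¹ X) (m≤m+n X Y))
  lem : ∀ x m y d → x * suc m + y * suc d ≡ (x * m + y * d) + (x + y)
  lem = solve-∀
  lem₂ : Y * (D ^ (2 * j) + D) ≡ X * M + Y * D
  lem₂ = trans (*-distribˡ-+ Y _ D) (cong (_+ Y * D) (sym eq))
  p∣X+Y : suc D ∣ X + Y
  p∣X+Y = ∣m+n∣m⇒∣n
    (subst (suc D ∣_) (lem X M Y D) (∣m∣n⇒∣m+n (∣n⇒∣m*n X p∣N) (n∣m*n Y)))
    (subst (suc D ∣_) lem₂ (∣n⇒∣m*n Y (1+D∣D^even+D D j)))
... | inj₂ (j , refl) = (j , refl) , sym (*-cancelˡ-≡ M (D ^ k) X (trans eq (cong (_* D ^ k) (sym X≡Y))))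
  where
  p∣XM+X : suc D ∣ X * M + X
  p∣XM+X = subst (suc D ∣_) (trans (*-suc X M) (+-comm X _)) (∣n⇒∣m*n X p∣N)
  p∣XM+Y : suc D ∣ X * M + Y
  p∣XM+Y = subst (suc D ∣_) (trans (*-distribˡ-+ Y _ 1) (cong₂ _+_ (sym eq) (*-identityʳ Y)))
    (∣n⇒∣m*n Y (1+D∣D^odd+1 D j))
  -- `A` and `B` are both ≡ -a modulo D + 1 and lie between 0 and D, so they agree. This gives X = Y
  -- for odd `k`.
  close : ∀ {a A B} → suc D ∣ a + A → suc D ∣ a + B → A ≤ B → B ≤ D → A ≡ B
  close {a} {A} {B} dA dB A≤B B≤D with B ∸ A in eq′ | ∣m+n∣m⇒∣n {suc D} {a + A} {B ∸ A}
    (subst (suc D ∣_) (trans (cong (a +_) (sym (m+[n∸m]≡n A≤B))) (sym (+-assoc a A _))) dB) dA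
  ... | zero | _ = ≤-antisym A≤B (m∸n≡0⇒m≤n eq′)
  ... | suc c | d = contradiction (∣⇒≤ d)
          (<⇒≱ (s≤s (≤-trans (≤-reflexive (sym eq′)) (≤-trans (m∸n≤m B A) B≤D))))
  X≡Y : X ≡ Y
  X≡Y with ≤-total X Y
  ... | inj₁ X≤Y = close p∣XM+X p∣XM+Y X≤Y (≤-trans (m≤n+m Y X) X+Y≤D)
  ... | inj₂ Y≤X = sym (close p∣XM+Y p∣XM+X Y≤X (≤-trans (m≤m+n X Y) X+Y≤D))

-- Multiplicative relations between n 2^n and m 2^t

^-distribʳ-* : ∀ k m n → (m * n) ^ k ≡ m ^ k * n ^ k
^-distribʳ-* zero m n = refl
^-distribʳ-* (suc k) m n = trans (cong (m * n *_) (^-distribʳ-* k m n)) (lem m n (m ^ k) (n ^ k))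
  where
  lem : ∀ a b c d → a * b * (c * d) ≡ a * c * (b * d)
  lem = solve-∀

2^n+2^n : ∀ n → 2 ^ n + 2 ^ n ≡ 2 ^ suc n
2^n+2^n n = cong (2 ^ n +_) (sym (+-identityʳ (2 ^ n)))

-- Write n = q t + r with r < t; the relation has exponent q if r is small, and q + 1 if t - r is small.
divisor-of-cullen⇒power : ∀ {n m t v e} .{{_ : NonZero n}} .{{_ : NonZero m}} .{{_ : NonZero t}} →
  n < 2 ^ v → m ^ (n / t) ≤ 2 ^ e → suc (e + v) ≤ t → suc (m * 2 ^ t) ∣ suc (n * 2 ^ n) →
  ∃[ k ] Odd k × (m * 2 ^ t) ^ k ≡ n * 2 ^ n
divisor-of-cullen⇒power {n} {m} {t@(suc t-1)} {v} {e} n<2^v m^q≤2^e e+v<t@(s≤s e+v≤t-1) p∣N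
  with n / t | n % t | m≡m%n+[m/n]*n n t | m%n<n n t
... | q | r | n≡r+qt | r<t with suc (r + v) ≤? t
... | yes (s≤s r+v<t) = q , small-relation⇒power q {{m^n≢0 m q}} p∣N eq sum
  where
  lem : ∀ a b c d → a * (b * (c * d)) ≡ b * c * (a * d)
  lem = solve-∀
  eq : m ^ q * (n * 2 ^ n) ≡ n * 2 ^ r * (m * 2 ^ t) ^ q
  eq = begin
    m ^ q * (n * 2 ^ n)  ≡⟨ cong (λ x → m ^ q * (n * 2 ^ x)) (trans n≡r+qt (cong (r +_) (*-comm q t))) ⟩
    m ^ q * (n * 2 ^ (r + t * q)) ≡⟨ cong (λ x → m ^ q * (n * x)) (^-distribˡ-+-* 2 r (t * q)) ⟩
    m ^ q * (n * (2 ^ r * 2 ^ (t * q))) ≡⟨ lem (m ^ q) n (2 ^ r) _ ⟩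
    n * 2 ^ r * (m ^ q * 2 ^ (t * q)) ≡⟨ cong (λ x → n * 2 ^ r * (m ^ q * x)) (^-*-assoc 2 t q) ⟨
    n * 2 ^ r * (m ^ q * (2 ^ t) ^ q) ≡⟨ cong (n * 2 ^ r *_) (^-distribʳ-* q m (2 ^ t)) ⟨
    n * 2 ^ r * (m * 2 ^ t) ^ q ∎
    where open ≡-Reasoning
  -- Each summand is at most 2^(t-1): the first since e ≤ t - 1, the second since r + v ≤ t - 1.
  sum : m ^ q + n * 2 ^ r ≤ m * 2 ^ t
  sum = begin
    m ^ q + n * 2 ^ r  ≤⟨ +-mono-≤ m^q≤2^e (*-monoˡ-≤ (2 ^ r) (<⇒≤ n<2^v)) ⟩
    2 ^ e + 2 ^ v * 2 ^ r ≡⟨ cong (2 ^ e +_) (^-distribˡ-+-* 2 v r) ⟨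
    2 ^ e + 2 ^ (v + r)
      ≤⟨ +-mono-≤ (^-monoʳ-≤ 2 (≤-trans (m≤m+n e v) e+v≤t-1))
                  (^-monoʳ-≤ 2 (≤-trans (≤-reflexive (+-comm v r)) r+v<t)) ⟩
    2 ^ t-1 + 2 ^ t-1 ≡⟨ 2^n+2^n t-1 ⟩
    2 ^ t ≤⟨ m≤n*m (2 ^ t) m ⟩
    m * 2 ^ t ∎
    where open ≤-Reasoning
-- Now t - r ≤ v. Multiplying M by 2^(t-r) fills the exponent n up to t (q + 1) at the price of a
-- factor of at most 2^v.
... | no r+v≮t = suc q , small-relation⇒power (suc q) {{m*n≢0 _ _ {{m^n≢0 m (suc q)}} {{m^n≢0 2 r′}}}} p∣N eq sum
  where
  r′ = t ∸ r
  r′≤v : r′ ≤ v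
  r′≤v = m≤n+o⇒m∸n≤o t r (s≤s⁻¹ (≰⇒> r+v≮t))
  n+r′ : n + r′ ≡ t * suc q
  n+r′ = begin
    n + r′ ≡⟨ cong (_+ r′) (trans n≡r+qt (+-comm r _)) ⟩
    q * t + r + r′ ≡⟨ +-assoc (q * t) r r′ ⟩
    q * t + (r + r′) ≡⟨ cong (q * t +_) (m+[n∸m]≡n (<⇒≤ r<t)) ⟩
    q * t + t ≡⟨ +-comm (q * t) t ⟩
    suc q * t ≡⟨ *-comm (suc q) t ⟩
    t * suc q ∎
    where open ≡-Reasoning
  lem : ∀ a b c d → a * b * (c * d) ≡ c * (a * (d * b))
  lem = solve-∀
  eq : m ^ suc q * 2 ^ r′ * (n * 2 ^ n) ≡ n * (m * 2 ^ t) ^ suc q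
  eq = begin
    m ^ suc q * 2 ^ r′ * (n * 2 ^ n)  ≡⟨ lem (m ^ suc q) (2 ^ r′) n (2 ^ n) ⟩
    n * (m ^ suc q * (2 ^ n * 2 ^ r′)) ≡⟨ cong (λ x → n * (m ^ suc q * x)) (^-distribˡ-+-* 2 n r′) ⟨
    n * (m ^ suc q * 2 ^ (n + r′)) ≡⟨ cong (λ x → n * (m ^ suc q * 2 ^ x)) n+r′ ⟩
    n * (m ^ suc q * 2 ^ (t * suc q)) ≡⟨ cong (λ x → n * (m ^ suc q * x)) (^-*-assoc 2 t (suc q)) ⟨
    n * (m ^ suc q * (2 ^ t) ^ suc q) ≡⟨ cong (n *_) (^-distribʳ-* (suc q) m (2 ^ t)) ⟨
    n * (m * 2 ^ t) ^ suc q ∎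
    where open ≡-Reasoning
  sum : m ^ suc q * 2 ^ r′ + n ≤ m * 2 ^ t
  sum = begin
    m ^ suc q * 2 ^ r′ + n ≡⟨ cong (_+ n) (*-assoc m (m ^ q) (2 ^ r′)) ⟩
    m * (m ^ q * 2 ^ r′) + n ≤⟨ +-mono-≤ (*-monoʳ-≤ m (*-mono-≤ m^q≤2^e (^-monoʳ-≤ 2 r′≤v))) (<⇒≤ n<2^v) ⟩
    m * (2 ^ e * 2 ^ v) + 2 ^ v ≡⟨ cong (λ x → m * x + 2 ^ v) (^-distribˡ-+-* 2 e v) ⟨
    m * 2 ^ (e + v) + 2 ^ v
      ≤⟨ +-mono-≤ (*-monoʳ-≤ m (^-monoʳ-≤ 2 e+v≤t-1)) (≤-trans (^-monoʳ-≤ 2 (≤-trans (m≤n+m v e) e+v≤t-1)) (m≤n*m (2 ^ t-1) m)) ⟩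
    m * 2 ^ t-1 + m * 2 ^ t-1 ≡⟨ *-distribˡ-+ m _ _ ⟨
    m * (2 ^ t-1 + 2 ^ t-1) ≡⟨ cong (m *_) (2^n+2^n t-1) ⟩
    m * 2 ^ t ∎
    where open ≤-Reasoning

-- Euler's totient of p m, and squarefreeness of C

private variable
  ℓ ℓ₁ ℓ₂ ℓ₃ : Level
  A : Set ℓ

applyUpTo-++ : ∀ (f : ℕ → A) m n → applyUpTo f (m + n) ≡ applyUpTo f m ++ applyUpTo (λ i → f (m + i)) n
applyUpTo-++ f zero n = refl
applyUpTo-++ f (suc m) n = cong (f 0 ∷_) (applyUpTo-++ (f ∘ suc) m n)

module _ {P : Pred ℕ ℓ₁} {Q : Pred ℕ ℓ₂} (P? : Decidable P) (Q? : Decidable Q) where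

  length-filter-applyUpTo-cong : ∀ f g n → (∀ i → P (f i) → Q (g i)) → (∀ i → Q (g i) → P (f i)) →
    length (filter P? (applyUpTo f n)) ≡ length (filter Q? (applyUpTo g n))
  length-filter-applyUpTo-cong f g zero to from = refl
  length-filter-applyUpTo-cong f g (suc n) to from with P? (f 0) | Q? (g 0)
  ... | yes _ | yes _ = cong suc (length-filter-applyUpTo-cong (f ∘ suc) (g ∘ suc) n (to ∘ suc) (from ∘ suc))
  ... | no _ | no _ = length-filter-applyUpTo-cong (f ∘ suc) (g ∘ suc) n (to ∘ suc) (from ∘ suc)
  ... | yes pf | no ¬qg = contradiction (to 0 pf) ¬qg
  ... | no ¬pf | yes qg = contradiction (from 0 qg) ¬pf

  -- Used with P for coprime to m, Q for divisible by p and R for coprime to p m.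
  length-filter-split : ∀ {R : Pred ℕ ℓ₃} (R? : Decidable R) →
    (∀ {x} → P x → ¬ Q x → R x) → (∀ {x} → R x → P x × ¬ Q x) →
    ∀ xs → length (filter P? xs) ≡ length (filter R? xs) + length (filter P? (filter Q? xs))
  length-filter-split R? to from [] = refl
  length-filter-split R? to from (x ∷ xs) with Q? x | R? x
  ... | yes qx | yes rx = contradiction qx (proj₂ (from rx))
  ... | yes qx | no ¬rx with P? x
  ...   | yes px = trans (cong suc (length-filter-split R? to from xs)) (sym (+-suc _ _))
  ...   | no ¬px = length-filter-split R? to from xs
  length-filter-split R? to from (x ∷ xs) | no ¬qx | yes rx with P? x
  ...   | yes px = cong suc (length-filter-split R? to from xs)
  ...   | no ¬px = contradiction (proj₁ (from rx)) ¬px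
  length-filter-split R? to from (x ∷ xs) | no ¬qx | no ¬rx with P? x
  ...   | yes px = contradiction (to px ¬qx) ¬rx
  ...   | no ¬px = length-filter-split R? to from xs

-- Induction over blocks of p consecutive numbers, of which only the last is a multiple of p. The
-- offset `c` counts the blocks already passed, so that the remaining list has the same shape.
filter-∣-applyUpTo : ∀ p .{{_ : NonZero p}} c n →
  filter (p ∣?_) (applyUpTo (λ i → c * p + suc i) (n * p)) ≡ applyUpTo (λ j → (c + suc j) * p) n
filter-∣-applyUpTo p c zero = refl
filter-∣-applyUpTo p@(suc p-1) c (suc n) = begin
  filter (p ∣?_) (applyUpTo f (p + n * p))
    -- The block length is written as (p - 1) + 1 to detach the last entry of the block.
    ≡⟨ cong (λ k → filter (p ∣?_) (applyUpTo f (k + n * p))) (+-comm 1 p-1) ⟩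
  filter (p ∣?_) (applyUpTo f (p-1 + 1 + n * p))
    ≡⟨ cong (filter (p ∣?_)) (trans (applyUpTo-++ f (p-1 + 1) (n * p))
        (cong (_++ rest) (applyUpTo-++ f p-1 1))) ⟩
  filter (p ∣?_) ((applyUpTo f p-1 ++ f (p-1 + 0) ∷ []) ++ rest)
    ≡⟨ trans (filter-++ (p ∣?_) (applyUpTo f p-1 ++ _ ∷ []) rest)
        (cong (_++ filter (p ∣?_) rest) (filter-++ (p ∣?_) (applyUpTo f p-1) (f (p-1 + 0) ∷ []))) ⟩
  (filter (p ∣?_) (applyUpTo f p-1) ++ filter (p ∣?_) (f (p-1 + 0) ∷ [])) ++ filter (p ∣?_) rest
    ≡⟨ cong₂ (λ xs ys → (xs ++ ys) ++ filter (p ∣?_) rest)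
        (filter-none (p ∣?_) (applyUpTo⁺₁ f p-1 not-multiple)) (filter-accept (p ∣?_) multiple) ⟩
  f (p-1 + 0) ∷ filter (p ∣?_) rest
    ≡⟨ cong₂ _∷_ (last≡ c p-1)
        (trans (cong (filter (p ∣?_)) (applyUpTo-cong shift≡ (n * p))) (filter-∣-applyUpTo p (suc c) n)) ⟩
  (c + 1) * p ∷ applyUpTo (λ j → (suc c + suc j) * p) n
    ≡⟨ cong ((c + 1) * p ∷_) (applyUpTo-cong (λ j → cong (_* p) (sym (+-suc c (suc j)))) n) ⟩
  applyUpTo (λ j → (c + suc j) * p) (suc n) ∎
  where
  open ≡-Reasoning
  f : ℕ → ℕ
  f i = c * p + suc i
  rest : List ℕ
  rest = applyUpTo (λ i → f (p-1 + 1 + i)) (n * p)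
  applyUpTo-cong : ∀ {f g : ℕ → ℕ} → (∀ i → f i ≡ g i) → ∀ n → applyUpTo f n ≡ applyUpTo g n
  applyUpTo-cong f≗g zero = refl
  applyUpTo-cong f≗g (suc n) = cong₂ _∷_ (f≗g 0) (applyUpTo-cong (f≗g ∘ suc) n)
  last≡ : ∀ c k → c * suc k + suc (k + 0) ≡ (c + 1) * suc k
  last≡ = solve-∀
  block : ∀ c k i → c * suc k + suc (k + 1 + i) ≡ suc c * suc k + suc i
  block = solve-∀
  shift≡ : ∀ i → f (p-1 + 1 + i) ≡ suc c * p + suc i
  shift≡ = block c p-1
  multiple : p ∣ f (p-1 + 0)
  multiple = subst (p ∣_) (sym (last≡ c p-1)) (n∣m*n (c + 1))
  not-multiple : ∀ {i} → i < p-1 → ¬ p ∣ f i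
  not-multiple i<p-1 p∣f = <⇒≱ (s≤s i<p-1) (∣⇒≤ (∣m+n∣m⇒∣n p∣f (n∣m*n c)))

coprimeCount : ℕ → ℕ → ℕ
coprimeCount m k = length (filter (λ i → coprime? i m) (applyUpTo suc k))

-- Coprimality to m depends only on the residue modulo m, so each block of m numbers contributes
-- φ(m).
coprimeCount-* : ∀ m c → coprimeCount m (c * m) ≡ c * φ m
coprimeCount-* m zero = refl
coprimeCount-* m (suc c) = begin
  length (filter P? (applyUpTo suc (m + c * m)))
    ≡⟨ cong (length ∘ filter P?) (applyUpTo-++ suc m (c * m)) ⟩
  length (filter P? (applyUpTo suc m ++ applyUpTo (λ i → suc (m + i)) (c * m)))
    ≡⟨ cong length (filter-++ P? (applyUpTo suc m) _) ⟩
  length (filter P? (applyUpTo suc m) ++ filter P? (applyUpTo (λ i → suc (m + i)) (c * m)))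
    ≡⟨ length-++ (filter P? (applyUpTo suc m)) ⟩
  φ m + length (filter P? (applyUpTo (λ i → suc (m + i)) (c * m)))
    ≡⟨ cong (φ m +_) (length-filter-applyUpTo-cong P? P? (λ i → suc (m + i)) suc (c * m) to from) ⟩
  φ m + coprimeCount m (c * m)
    ≡⟨ cong (φ m +_) (coprimeCount-* m c) ⟩
  φ m + c * φ m ∎
  where
  open ≡-Reasoning
  P? : Decidable (λ i → Coprime i m)
  P? i = coprime? i m
  to : ∀ i → Coprime (suc (m + i)) m → Coprime (suc i) m
  to i cop {d} (d∣i , d∣m) = cop (subst (d ∣_) (+-suc m i) (∣m∣n⇒∣m+n d∣m d∣i) , d∣m)
  from : ∀ i → Coprime (suc i) m → Coprime (suc (m + i)) m
  from i cop {d} (d∣mi , d∣m) = cop (∣m+n∣m⇒∣n (subst (d ∣_) (sym (+-suc m i)) d∣mi) d∣m , d∣m)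

module _ {p : ℕ} (p-prime : Prime p) where

  prime∤⇒coprime : ∀ {k} → ¬ p ∣ k → Coprime k p
  prime∤⇒coprime p∤k (d∣k , d∣p) with prime⇒irreducible p-prime d∣p
  ... | inj₁ d≡1 = d≡1
  ... | inj₂ refl = contradiction d∣k p∤k

  coprime-prime* : ∀ {k m} → Coprime k m → ¬ p ∣ k → Coprime k (p * m)
  coprime-prime* cop p∤k (d∣k , d∣pm) = cop (d∣k , coprime-divisor
    (λ (e∣d , e∣p) → prime∤⇒coprime p∤k (∣-trans e∣d d∣k , e∣p)) d∣pm)

  -- When p divides m, coprime to p m means coprime to m, and there are p blocks of length m.
  φ-prime* : ∀ {m} → p ∣ m → φ (p * m) ≡ p * φ m
  φ-prime* {m} p∣m = trans
    (length-filter-applyUpTo-cong (λ i → coprime? i (p * m)) (λ i → coprime? i m) suc suc (p * m)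
      (λ _ cop (d∣i , d∣m) → cop (d∣i , ∣n⇒∣m*n p d∣m))
      (λ i cop → coprime-prime* cop (λ p∣i → ¬prime[1] (subst Prime (cop (p∣i , p∣m)) p-prime))))
    (coprimeCount-* m p)

  -- Of the p φ(m) numbers up to p m that are coprime to m, those not coprime to p m are the
  -- multiples j p with j ≤ m coprime to m. There are φ(m) of them, added on both sides instead of
  -- subtracted.
  φ-coprime-prime* : ∀ {m} → ¬ p ∣ m → φ (p * m) ≡ pred p * φ m
  φ-coprime-prime* {m} p∤m = +-cancelʳ-≡ (φ m) _ _ (begin
    φ (p * m) + φ m
      ≡⟨ cong (φ (p * m) +_) multiples ⟨
    φ (p * m) + length (filter P? (filter (p ∣?_) (applyUpTo suc (p * m))))
      ≡⟨ length-filter-split P? (p ∣?_) (λ i → coprime? i (p * m)) coprime-prime*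
          (λ cop → (λ (d∣i , d∣m) → cop (d∣i , ∣n⇒∣m*n p d∣m)) ,
                   (λ p∣i → ¬prime[1] (subst Prime (cop (p∣i , m∣m*n m)) p-prime)))
          (applyUpTo suc (p * m)) ⟨
    coprimeCount m (p * m)    ≡⟨ coprimeCount-* m p ⟩
    p * φ m                   ≡⟨ cong (_* φ m) (suc-pred p {{prime⇒nonZero p-prime}}) ⟨
    φ m + pred p * φ m        ≡⟨ +-comm (φ m) _ ⟩
    pred p * φ m + φ m ∎)
    where
    open ≡-Reasoning
    instance _ = prime⇒nonZero p-prime
    P? : Decidable (λ i → Coprime i m)
    P? i = coprime? i m
    m⊥p : Coprime m p
    m⊥p = prime∤⇒coprime p∤m
    multiples : length (filter P? (filter (p ∣?_) (applyUpTo suc (p * m)))) ≡ φ m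
    multiples = begin
      length (filter P? (filter (p ∣?_) (applyUpTo suc (p * m))))
        ≡⟨ cong (λ k → length (filter P? (filter (p ∣?_) (applyUpTo suc k)))) (*-comm p m) ⟩
      length (filter P? (filter (p ∣?_) (applyUpTo suc (m * p))))
        ≡⟨ cong (length ∘ filter P?) (filter-∣-applyUpTo p 0 m) ⟩
      length (filter P? (applyUpTo (λ j → suc j * p) m))
        ≡⟨ length-filter-applyUpTo-cong P? P? (λ j → suc j * p) suc m
            (λ j cop (d∣j , d∣m) → cop (∣m⇒∣m*n p d∣j , d∣m))
            (λ j cop {d} (d∣jp , d∣m) → cop (coprime-divisor (λ (e∣d , e∣p) → m⊥p (∣-trans e∣d d∣m , e∣p))
               (subst (d ∣_) (*-comm (suc j) p) d∣jp) , d∣m)) ⟩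
      φ m ∎

-- A prime that occurs twice divides the totient as well as the product, and further primes do not
-- destroy this. Without repetition the totient is multiplicative.
square-or-φ-product : ∀ {ps} → All Prime ps →
  (Unique ps × φ (product ps) ≡ product (map pred ps)) ⊎
  (∃[ p ] Prime p × p ∣ product ps × p ∣ φ (product ps))
square-or-φ-product [] = inj₁ ([] , refl)
square-or-φ-product {p ∷ ps} (p-prime ∷ ps-prime) with p ∣? product ps | square-or-φ-product ps-prime
... | yes p∣P | _ = inj₂ (p , p-prime , m∣m*n _ , subst (p ∣_) (sym (φ-prime* p-prime p∣P)) (m∣m*n _))
... | no p∤P | inj₁ (unique , φP) = inj₁
      ( All.tabulate (λ x∈ps p≡x → p∤P (∈⇒∣product (subst (_∈ ps) (sym p≡x) x∈ps))) ∷ unique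
      , trans (φ-coprime-prime* p-prime p∤P) (cong (pred p *_) φP))
... | no p∤P | inj₂ (q , q-prime , q∣P , q∣φP) = inj₂
      (q , q-prime , ∣n⇒∣m*n p q∣P , subst (q ∣_) (sym (φ-coprime-prime* p-prime p∤P)) (∣n⇒∣m*n (pred p) q∣φP))

-- A prime dividing both M + 1 and its totient would divide M too, hence 1.
φ∣pred⇒unique : ∀ {ps M} → All Prime ps → product ps ≡ suc M → φ (product ps) ∣ M →
  Unique ps × product (map pred ps) ∣ M
φ∣pred⇒unique {ps} {M} ps-prime P≡1+M φ∣M with square-or-φ-product ps-prime
... | inj₁ (unique , φP) = unique , subst (_∣ M) φP φ∣M
... | inj₂ (q , q-prime , q∣P , q∣φP) = contradiction (subst Prime (∣1⇒≡1 q∣1) q-prime) ¬prime[1]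
  where
  q∣1 : q ∣ 1
  q∣1 = ∣m+n∣m⇒∣n (subst (q ∣_) (trans P≡1+M (+-comm 1 M)) q∣P) (∣-trans q∣φP φ∣M)

-- Splitting divisors of a product along its two factors

nonZero-∣ : ∀ {m n} .{{_ : NonZero n}} → m ∣ n → NonZero m
nonZero-∣ {zero} {n} 0∣n = contradiction (0∣⇒≡0 0∣n) (≢-nonZero⁻¹ n)
nonZero-∣ {suc m} _ = _

gcd-quotients : ∀ m n .{{_ : NonZero m}} →
  ∃[ g ] ∃₂ λ u w → NonZero g × m ≡ u * g × n ≡ w * g × Coprime u w
gcd-quotients m n = g , u , w , g≢0 , m≡ug , n≡wg , GCD≡1⇒coprime (GCD-* {{g≢0}}
  (subst₂ (λ x y → GCD x y (1 * g)) m≡ug n≡wg (subst (GCD m n) (sym (*-identityˡ g)) (gcd-GCD m n))))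
  where
  g = gcd m n
  g∣m = gcd[m,n]∣m m n
  g∣n = gcd[m,n]∣n m n
  g≢0 : NonZero g
  g≢0 = nonZero-∣ g∣m
  u = quotient g∣m
  w = quotient g∣n
  m≡ug : m ≡ u * g
  m≡ug = m∣n⇒n≡quotient*m g∣m
  n≡wg : n ≡ w * g
  n≡wg = m∣n⇒n≡quotient*m g∣n

-- Take d = gcd(D, a); then D / d is coprime to a / d and divides (a / d) b, so it divides b.
∣-*-split : ∀ {D} a b .{{_ : NonZero D}} → D ∣ a * b → ∃₂ λ d e → D ≡ d * e × d ∣ a × e ∣ b
∣-*-split {D} a b D∣ab with gcd-quotients D a
... | g , u , w , g≢0 , refl , refl , u⊥w = g , u , *-comm u g , n∣m*n w ,
  coprime-divisor u⊥w (*-cancelʳ-∣ g {{g≢0}} (subst (u * g ∣_) (lem w g b) D∣ab))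
  where
  lem : ∀ w g b → w * g * b ≡ w * b * g
  lem = solve-∀

∣2^n⇒≡2^t : ∀ {e} n → e ∣ 2 ^ n → ∃[ t ] t ≤ n × e ≡ 2 ^ t
∣2^n⇒≡2^t zero e∣1 = 0 , z≤n , ∣1⇒≡1 e∣1
∣2^n⇒≡2^t (suc n) e∣2^[1+n] with ∣-*-split 2 (2 ^ n) {{nonZero-∣ {{m^n≢0 2 (suc n)}} e∣2^[1+n]}} e∣2^[1+n]
... | d , e′ , refl , d∣2 , e′∣2^n with prime⇒irreducible prime[2] d∣2 | ∣2^n⇒≡2^t n e′∣2^n
... | inj₁ refl | t , t≤n , refl = t , m≤n⇒m≤1+n t≤n , +-identityʳ _
... | inj₂ refl | t , t≤n , refl = suc t , s≤s t≤n , refl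

-- After splitting the first entry as d e, the product of the rest divides (a / d)(b / e). Dividing
-- out in this way makes the product of all the cofactors divide `a`, which is stronger than each of
-- them dividing it.
product-∣-*-split : ∀ {ds} a b .{{_ : NonZero b}} → All NonZero ds → product ds ∣ a * b →
  ∃[ ms ] product ms ∣ a × Pointwise (λ D m → ∃[ e ] e ∣ b × D ≡ m * e) ds ms
product-∣-*-split a b [] _ = [] , 1∣ a , []
product-∣-*-split {D ∷ ds} a b (D≢0 ∷ ds≢0) DR∣ab with ∣-*-split a b {{D≢0}} (m*n∣⇒m∣ D (product ds) DR∣ab)
... | d , e , refl , divides a′ refl , divides b′ refl
  with product-∣-*-split a′ b′ {{m*n≢0⇒m≢0 b′}} ds≢0
    (*-cancelˡ-∣ (d * e) {{D≢0}} (subst (d * e * product ds ∣_) (lem a′ d b′ e) DR∣ab))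
  where
  lem : ∀ a d b e → a * d * (b * e) ≡ d * e * (a * b)
  lem = solve-∀
... | ms , P∣a′ , pw = d ∷ ms , subst (d * product ms ∣_) (*-comm d a′) (*-monoʳ-∣ d P∣a′)
    , (e , n∣m*n b′ , refl) ∷ weaken pw
  where
  weaken : ∀ {ds ms} → Pointwise (λ D m → ∃[ e ] e ∣ b′ × D ≡ m * e) ds ms →
    Pointwise (λ D m → ∃[ e ] e ∣ b × D ≡ m * e) ds ms
  weaken [] = []
  weaken ((e′ , e′∣b′ , eq) ∷ pw) = (e′ , ∣m⇒∣m*n e e′∣b′ , eq) ∷ weaken pw

-- Equal powers and their common root

^-cancelˡ-∣ : ∀ {m n} k .{{_ : NonZero m}} .{{_ : NonZero k}} → m ^ k ∣ n ^ k → m ∣ n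
^-cancelˡ-∣ {m} {n} k@(suc k-1) m^k∣n^k with gcd-quotients m n
-- Removing the gcd leaves coprime u and w with u^k dividing w^k, which forces u = 1.
... | g , u , w , g≢0 , refl , refl , u⊥w = subst (λ x → x * g ∣ w * g) (sym u≡1) (*-monoˡ-∣ g (1∣ w))
  where
  u^k∣w^k : u ^ k ∣ w ^ k
  u^k∣w^k = *-cancelʳ-∣ (g ^ k) {{m^n≢0 g k {{g≢0}}}}
    (subst₂ _∣_ (^-distribʳ-* k u g) (^-distribʳ-* k w g) m^k∣n^k)
  coprime-^ : ∀ j → u ∣ w ^ j → u ∣ 1
  coprime-^ zero u∣1 = u∣1
  coprime-^ (suc j) u∣w^[1+j] = coprime-^ j (coprime-divisor u⊥w u∣w^[1+j])
  u≡1 : u ≡ 1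
  u≡1 = ∣1⇒≡1 (coprime-^ k (∣-trans (m∣m*n (u ^ k-1)) u^k∣w^k))

^-cancelˡ-≡ : ∀ {m n} k .{{_ : NonZero m}} .{{_ : NonZero n}} .{{_ : NonZero k}} → m ^ k ≡ n ^ k → m ≡ n
^-cancelˡ-≡ k eq = ∣-antisym (^-cancelˡ-∣ k (∣-reflexive eq)) (^-cancelˡ-∣ k (∣-reflexive (sym eq)))

-- The exponents `b` and `a` are tied to `i` and `j` by a factor `g`, so that they are odd whenever
-- `i` and `j` are.
CommonRoot : (D E i j : ℕ) → Set
CommonRoot D E i j = ∃₂ λ X g → ∃₂ λ a b → D ≡ X ^ a × E ≡ X ^ b × i ≡ b * g × j ≡ a * g

private
  -- One Euclidean step: E^i divides D^i, hence E divides D, and the quotient F satisfies a relation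
  -- with the smaller exponents i and k.
  divide : ∀ {D E} i k .{{_ : NonZero E}} .{{_ : NonZero i}} →
    D ^ i ≡ E ^ (i + k) → ∃[ F ] D ≡ F * E × F ^ i ≡ E ^ k
  divide {D} {E} i k D^i≡E^[i+k] with ^-cancelˡ-∣ {E} {D} i
    (subst (E ^ i ∣_) (sym (trans D^i≡E^[i+k] (^-distribˡ-+-* E i k))) (m∣m*n (E ^ k)))
  ... | divides F refl = F , refl , *-cancelʳ-≡ _ _ (E ^ i) {{m^n≢0 E i}}
    (trans (sym (^-distribʳ-* i F E)) (trans D^i≡E^[i+k] (trans (^-distribˡ-+-* E i k) (*-comm (E ^ i) (E ^ k)))))

-- The Euclidean algorithm on the exponents; s bounds their sum.
common-root : ∀ s {D E} i j .{{_ : NonZero D}} .{{_ : NonZero E}} .{{_ : NonZero i}} .{{_ : NonZero j}} →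
  i + j ≤ s → D ^ i ≡ E ^ j → CommonRoot D E i j
common-root zero (suc i) j () _
common-root (suc s) {D} {E} i@(suc i-1) j@(suc j-1) i+j≤1+s D^i≡E^j with compare i j
... | equal _ = D , i , 1 , 1 , sym (*-identityʳ D) , trans (sym (^-cancelˡ-≡ i D^i≡E^j)) (sym (*-identityʳ D))
      , sym (+-identityʳ i) , sym (+-identityʳ i)
... | less _ k with divide {D} {E} i (suc k) (trans D^i≡E^j (cong (E ^_) (sym (+-suc i k))))
...   | F , refl , F^i≡E^[1+k] with common-root s {F} {E} i (suc k) {{m*n≢0⇒m≢0 F}} bound F^i≡E^[1+k]
  where
  bound : i + suc k ≤ s
  bound = ≤-trans (≤-reflexive (+-suc i k)) (≤-trans (m≤n+m _ i-1) (s≤s⁻¹ i+j≤1+s))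
...     | X , g , a , b , refl , refl , i≡bg , k≡ag = X , g , a + b , b
      , sym (^-distribˡ-+-* X a b) , refl , i≡bg
      , trans (sym (+-suc i k)) (trans (cong₂ _+_ i≡bg k≡ag) (trans (+-comm (b * g) (a * g)) (sym (*-distribʳ-+ g a b))))
common-root (suc s) {D} {E} i@(suc i-1) j@(suc j-1) i+j≤1+s D^i≡E^j | greater _ k
  with divide {E} {D} j (suc k) (trans (sym D^i≡E^j) (cong (D ^_) (sym (+-suc j k))))
... | F , refl , F^j≡D^[1+k] with common-root s {D} {F} (suc k) j {{it}} {{m*n≢0⇒m≢0 F}} bound (sym F^j≡D^[1+k])
  where
  bound : suc k + j ≤ s
  bound = ≤-trans (≤-reflexive (cong suc (+-comm k j))) (≤-trans (m≤m+n _ j-1)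
    (≤-trans (≤-reflexive (sym (+-suc _ j-1))) (s≤s⁻¹ i+j≤1+s)))
...   | X , g , a , b , refl , refl , k≡bg , j≡ag = X , g , a , b + a
      , refl , sym (^-distribˡ-+-* X b a)
      , trans (sym (+-suc j k)) (trans (cong₂ _+_ j≡ag k≡bg) (trans (+-comm (a * g) (b * g)) (sym (*-distribʳ-+ g b a))))
      , j≡ag

odd-*⇒odd : ∀ a g → Odd (a * g) → Odd a
odd-*⇒odd a g (j , ag≡1+2j) with even⊎odd a
... | inj₂ odd = odd
... | inj₁ (c , refl) = contradiction (trans (sym (*-assoc 2 c g)) ag≡1+2j) (even≢odd (c * g) j)

-- X + 1 divides the prime X^a + 1 and therefore equals it. One cannot conclude a = 1, because X may
-- be 1.
odd-power-prime : ∀ X {a} → Odd a → Prime (suc (X ^ a)) → X ≡ X ^ a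
odd-power-prime X (j , refl) X^a+1-prime with prime⇒irreducible X^a+1-prime
  (subst (suc X ∣_) (+-comm _ 1) (1+D∣D^odd+1 X j))
... | inj₁ 1+X≡1 = contradiction (subst (λ x → Prime (suc (x ^ suc (2 * j)))) (suc-injective 1+X≡1) X^a+1-prime) ¬prime[1]
... | inj₂ 1+X≡1+D = suc-injective 1+X≡1+D

-- X + 1 divides both X ^ a + 1 and X ^ b + 1 for odd a and b.
prime-root-unique : ∀ {D E i j} → Prime (suc D) → Prime (suc E) → Odd i → Odd j → D ^ i ≡ E ^ j → D ≡ E
prime-root-unique {zero} p _ _ _ _ = contradiction p ¬prime[1]
prime-root-unique {suc _} {zero} _ p _ _ _ = contradiction p ¬prime[1]
prime-root-unique {suc _} {suc _} {i} {j} D-prime E-prime (i′ , refl) (j′ , refl) eq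
  with common-root (i + j) i j ≤-refl eq
... | X , g , a , b , D≡X^a , E≡X^b , i≡bg , j≡ag = trans D≡X^a (trans
      (sym (odd-power-prime X (odd-*⇒odd a g (j′ , sym j≡ag)) (subst (λ x → Prime (suc x)) D≡X^a D-prime)))
      (trans (odd-power-prime X (odd-*⇒odd b g (i′ , sym i≡bg)) (subst (λ x → Prime (suc x)) E≡X^b E-prime)) (sym E≡X^b)))

-- Bounds for products of distinct numbers

unique-⊆⇒product-≤ : ∀ {xs ys} → Unique xs → (∀ {x} → x ∈ xs → x ∈ ys) → All NonZero ys → product xs ≤ product ys
unique-⊆⇒product-≤ {[]} [] _ ys≢0 = product≥1 ys≢0
  where
  product≥1 : ∀ {ys} → All NonZero ys → 1 ≤ product ys
  product≥1 [] = ≤-refl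
  product≥1 {y ∷ _} (y≢0 ∷ ys≢0) = *-mono-≤ (>-nonZero⁻¹ y {{y≢0}}) (product≥1 ys≢0)
unique-⊆⇒product-≤ {x ∷ xs} (x∉xs ∷ unique) xs⊆ys ys≢0 with ∈-∃++ (xs⊆ys (here refl))
-- `x` is moved to the front of the larger list and cancelled. As it does not recur in `xs`, the
-- other entries of `xs` still occur in what remains.
... | us , vs , refl = subst (x * product xs ≤_) (sym (product-↭ perm))
  (*-monoʳ-≤ x (unique-⊆⇒product-≤ unique xs⊆us++vs (All.tail (All-resp-↭ perm ys≢0))))
  where
  perm = shift x us vs
  xs⊆us++vs : ∀ {y} → y ∈ xs → y ∈ us ++ vs
  xs⊆us++vs y∈xs with ∈-resp-↭ perm (xs⊆ys (there y∈xs))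
  ... | here refl = contradiction refl (All.lookup x∉xs y∈xs)
  ... | there y∈ = y∈

-- The entries in `L` are distinct and contribute at most its product. The others contribute at most
-- the powers m^K, which multiply to a K-th power; for entries in `L` a factor m^K ≥ 1 is thrown in.
product-≤-exceptions : ∀ {L ps ms K} → Unique ps → All NonZero L →
  Pointwise (λ p m → NonZero m × (p ∈ L ⊎ p ≤ m ^ K)) ps ms → product ps ≤ product L * product ms ^ K
product-≤-exceptions {L} {ps} {K = K} unique L≢0 pw = ≤-trans (split pw) (*-monoˡ-≤ _
    (unique-⊆⇒product-≤ (filter⁺ (_∈? L) unique) (λ x∈ → proj₂ (∈-filter⁻ (_∈? L) {xs = ps} x∈)) L≢0))
  where
  split : ∀ {ps ms} → Pointwise (λ p m → NonZero m × (p ∈ L ⊎ p ≤ m ^ K)) ps ms →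
    product ps ≤ product (filter (_∈? L) ps) * product ms ^ K
  split [] = ≤-reflexive (sym (trans (+-identityʳ _) (^-zeroˡ K)))
  split {p ∷ ps} {m ∷ ms} ((m≢0 , p-bound) ∷ pw) with p ∈? L | p-bound
  ... | yes _ | _ = ≤-trans (*-monoʳ-≤ p (split pw)) (≤-trans (≤-reflexive (sym (*-assoc p _ _)))
        (*-monoʳ-≤ (p * product (filter (_∈? L) ps)) (^-monoˡ-≤ K (m≤n*m (product ms) m {{m≢0}}))))
  ... | no p∉L | inj₁ p∈L = contradiction p∈L p∉L
  ... | no _ | inj₂ p≤m^K = ≤-trans (*-mono-≤ p≤m^K (split pw)) (≤-reflexive
        (trans (lem (m ^ K) (product (filter (_∈? L) ps)) (product ms ^ K))
          (cong (product (filter (_∈? L) ps) *_) (sym (^-distribʳ-* K m (product ms))))))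
    where
    lem : ∀ x y z → x * (y * z) ≡ y * (x * z)
    lem = solve-∀

-- Prime factors of a composite Cullen number

record CullenFactor (n p m : ℕ) : Set where
  field
    p-prime : Prime p
    p∣C : p ∣ suc (n * 2 ^ n)
    -- Compositeness of C enters here. It rules out exponent 1 in D^k = M and excludes C itself from
    -- the enumeration for small n.
    p<C : p < suc (n * 2 ^ n)
    m∣n : m ∣ n
    {t} : ℕ
    t≤n : t ≤ n
    p≡ : p ≡ suc (m * 2 ^ t)

record CullenFactors (n : ℕ) : Set where
  field
    {primes cofactors} : List ℕ
    primes-unique : Unique primes
    product-primes : product primes ≡ suc (n * 2 ^ n)
    product-cofactors : product cofactors ∣ n
    factors : Pointwise (CullenFactor n) primes cofactors

cullen-factors : ∀ n .{{_ : NonZero n}} → ¬ Prime (suc (n * 2 ^ n)) →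
  φ (suc (n * 2 ^ n)) ∣ n * 2 ^ n → CullenFactors n
cullen-factors n ¬prime φ∣M = result
  where
  M = n * 2 ^ n
  open PrimeFactorisation (factorise (suc M)) renaming (factors to ps; isFactorisation to C≡; factorsPrime to ps-prime)
  unique×∣ : Unique ps × product (map pred ps) ∣ M
  unique×∣ = φ∣pred⇒unique ps-prime (sym C≡) (subst (λ x → φ x ∣ M) C≡ φ∣M)

  pred≢0 : ∀ {ps} → All Prime ps → All NonZero (map pred ps)
  pred≢0 [] = []
  pred≢0 {suc (suc _) ∷ _} (_ ∷ ps) = _ ∷ pred≢0 ps
  pred≢0 {suc zero ∷ _} (p ∷ _) = contradiction p ¬prime[1]
  pred≢0 {zero ∷ _} (p ∷ _) = contradiction p ¬prime[0]

  collect : ∀ {ps ms} → All Prime ps → (∀ {p} → p ∈ ps → p ∣ suc M) → (∀ {m} → m ∈ ms → m ∣ n) →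
    Pointwise (λ D m → ∃[ e ] e ∣ 2 ^ n × D ≡ m * e) (map pred ps) ms → Pointwise (CullenFactor n) ps ms
  collect {[]} [] _ _ [] = []
  collect {p ∷ ps} {m ∷ ms} (p-prime ∷ ps-prime) ps∣C ms∣n ((e , e∣2^n , D≡me) ∷ pw)
    with ∣2^n⇒≡2^t n e∣2^n
  ... | t , t≤n , refl = record
    { p-prime = p-prime
    ; p∣C = ps∣C (here refl)
    ; p<C = ≤∧≢⇒< (∣⇒≤ (ps∣C (here refl))) (λ p≡C → ¬prime (subst Prime p≡C p-prime))
    ; m∣n = ms∣n (here refl)
    ; t≤n = t≤n
    ; p≡ = trans (sym (suc-pred p {{prime⇒nonZero p-prime}})) (cong suc D≡me)
    } ∷ collect ps-prime (ps∣C ∘ there) (ms∣n ∘ there) pw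

  result : CullenFactors n
  result with product-∣-*-split n (2 ^ n) {{m^n≢0 2 n}} (pred≢0 ps-prime) (proj₂ unique×∣)
  ... | ms , Πms∣n , pw = record
    { primes-unique = proj₁ unique×∣
    ; product-primes = sym C≡
    ; product-cofactors = Πms∣n
    ; factors = collect ps-prime (λ p∈ps → subst (_ ∣_) (sym C≡) (∈⇒∣product p∈ps))
        (λ m∈ms → ∣-trans (∈⇒∣product m∈ms) Πms∣n) pw
    }

-- Classification of the prime factors and the bound for C

PowerRoot : ℕ → ℕ → Set
PowerRoot M p = Prime p × ∃₂ λ D k → p ≡ suc D × Odd k × D ^ k ≡ M

-- Since D < M the odd exponent is not 1, so it is at least 3.
proper-root-cube≤ : ∀ {D k M} .{{_ : NonZero D}} → Odd k → D ^ k ≡ M → D < M → D ^ 3 ≤ M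
proper-root-cube≤ {D} (zero , refl) D^1≡M D<M = contradiction (trans (sym (^-identityʳ D)) D^1≡M) (<⇒≢ D<M)
proper-root-cube≤ {D} (suc j , refl) refl _ = ^-monoʳ-≤ D (s≤s (subst (2 ≤_) (sym (*-suc 2 j)) (m≤m+n 2 (2 * j))))

^-cancelˡ-≤ : ∀ m n k → m ^ suc k ≤ n ^ suc k → m ≤ n
^-cancelˡ-≤ m n k m^≤n^ = ≮⇒≥ (λ n<m → <⇒≱ (^-monoˡ-< (suc k) n<m) m^≤n^)

^-cancelʳ-< : ∀ {m n} k .{{_ : NonZero k}} → k ^ m < k ^ n → m < n
^-cancelʳ-< k k^m<k^n = ≰⇒> (λ n≤m → <⇒≱ k^m<k^n (^-monoʳ-≤ k n≤m))

-- Here v bounds log n to base 2 and b bounds the square root of n. For m = 1 the dividing line is t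
-- ≤ v; for m ≥ 2 it is 2^t ≤ m^(b+v). Beyond it, t is large enough for `divisor-of-cullen⇒power`.
factor-classification : ∀ {n v b} .{{_ : NonZero n}} .{{_ : NonZero (b + v)}} → n < 2 ^ v → n ≤ b * b →
  ∀ {p m} → CullenFactor n p m →
  PowerRoot (n * 2 ^ n) p ⊎ NonZero m × ((∃[ t ] t < suc v × p ≡ suc (2 ^ t)) ⊎ p ≤ m ^ (2 + (b + v)))
factor-classification {n} _ _ {m = zero} record { m∣n = 0∣n } = contradiction (0∣⇒≡0 0∣n) (≢-nonZero⁻¹ n)
factor-classification {n} {v} n<2^v _ {m = suc zero} record { p-prime = p-prime; p∣C = p∣C; t = t; p≡ = refl } with t ≤? v
... | yes t≤v = inj₂ (_ , inj₁ (t , s≤s t≤v , cong suc (+-identityʳ (2 ^ t))))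
... | no t≰v with divisor-of-cullen⇒power {m = 1} {e = 0} {{it}} {{_}} {{>-nonZero (≤-<-trans z≤n (≰⇒> t≰v))}}
                    n<2^v (≤-reflexive (^-zeroˡ (_/_ n t {{>-nonZero (≤-<-trans z≤n (≰⇒> t≰v))}}))) (≰⇒> t≰v) p∣C
...   | k , k-odd , D^k≡M = inj₁ (p-prime , 1 * 2 ^ t , k , refl , k-odd , D^k≡M)
factor-classification {n} {v} {b} n<2^v n≤b² {m = m@(suc (suc _))} record { p-prime = p-prime; p∣C = p∣C; t = t; p≡ = refl }
  with 2 ^ t ≤? m ^ (b + v)
... | yes 2^t≤m^C = inj₂ (_ , inj₂ (begin
    suc (m * 2 ^ t)                 ≤⟨ s≤s (*-monoʳ-≤ m 2^t≤m^C) ⟩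
    suc (m ^ suc (b + v))           ≤⟨ +-monoˡ-≤ (m ^ suc (b + v)) (m^n>0 m (suc (b + v))) ⟩
    m ^ suc (b + v) + m ^ suc (b + v) ≡⟨ cong (m ^ suc (b + v) +_) (+-identityʳ _) ⟨
    2 * m ^ suc (b + v)             ≤⟨ *-monoˡ-≤ (m ^ suc (b + v)) {2} {m} (s≤s (s≤s z≤n)) ⟩
    m * m ^ suc (b + v) ∎))
  where open ≤-Reasoning
... | no 2^t≰m^C with divisor-of-cullen⇒power {e = b} {{it}} {{_}} {{t≢0}} n<2^v m^q≤2^b C<t p∣C
  where
  C = b + v
  m^C<2^t : m ^ C < 2 ^ t
  m^C<2^t = ≰⇒> 2^t≰m^C
  -- Since m ≥ 2, 2^C ≤ m^C < 2^t.
  C<t : C < t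
  C<t = ^-cancelʳ-< 2 (≤-<-trans (^-monoˡ-≤ C (s≤s (s≤s z≤n))) m^C<2^t)
  t≢0 : NonZero t
  t≢0 = >-nonZero (≤-<-trans z≤n C<t)
  q = _/_ n t {{t≢0}}
  -- Compare C-th powers: m^(Cq) ≤ 2^(tq) ≤ 2^n ≤ 2^(bC), as n ≤ b^2 ≤ b C.
  m^q≤2^b : m ^ q ≤ 2 ^ b
  m^q≤2^b = ^-cancelˡ-≤ (m ^ q) (2 ^ b) (pred C) (subst (λ x → (m ^ q) ^ x ≤ (2 ^ b) ^ x) (sym (suc-pred C)) (begin
    (m ^ q) ^ C   ≡⟨ ^-*-assoc m q C ⟩
    m ^ (q * C)   ≡⟨ cong (m ^_) (*-comm q C) ⟩
    m ^ (C * q)   ≡⟨ ^-*-assoc m C q ⟨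
    (m ^ C) ^ q   ≤⟨ ^-monoˡ-≤ q (<⇒≤ m^C<2^t) ⟩
    (2 ^ t) ^ q   ≡⟨ ^-*-assoc 2 t q ⟩
    2 ^ (t * q)   ≤⟨ ^-monoʳ-≤ 2 (≤-trans (≤-reflexive (*-comm t q)) (m/n*n≤m n t {{t≢0}})) ⟩
    2 ^ n         ≤⟨ ^-monoʳ-≤ 2 (≤-trans n≤b² (*-monoʳ-≤ b (m≤m+n b v))) ⟩
    2 ^ (b * C)   ≡⟨ ^-*-assoc 2 b C ⟨
    (2 ^ b) ^ C ∎))
    where open ≤-Reasoning
...   | k , k-odd , D^k≡M = inj₁ (p-prime , m * 2 ^ t , k , refl , k-odd , D^k≡M)

module _ {R S : ℕ → ℕ → Set} {E : ℕ → Set} (f : ∀ {p m} → R p m → E p ⊎ S p m) where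
  find-exception : ∀ {ps ms} → Pointwise R ps ms → Pointwise S ps ms ⊎ (∃₂ λ p m → R p m × E p)
  find-exception [] = inj₁ []
  find-exception (r ∷ rs) with f r | find-exception rs
  ... | inj₁ e | _ = inj₂ (_ , _ , r , e)
  ... | inj₂ s | inj₁ ss = inj₁ (s ∷ ss)
  ... | inj₂ _ | inj₂ found = inj₂ found

product-≤-^ : ∀ {B xs} → All (_≤ B) xs → product xs ≤ B ^ length xs
product-≤-^ [] = ≤-refl
product-≤-^ (x≤B ∷ xs≤B) = *-mono-≤ x≤B (product-≤-^ xs≤B)

powersOfTwo+1 : ℕ → List ℕ
powersOfTwo+1 v = applyUpTo (λ t → suc (2 ^ t)) (suc v)

-- The three factors bound the exceptional prime D + 1, the v + 1 numbers 2^t + 1 with t ≤ v, and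
-- the remaining primes, whose cofactors have a product of at most n.
cullen-≤ : ∀ {n v b} .{{_ : NonZero n}} .{{_ : NonZero (b + v)}} → n < 2 ^ v → n ≤ b * b → CullenFactors n →
  ∃[ D ] D ^ 3 ≤ n * 2 ^ n × suc (n * 2 ^ n) ≤ suc D * (2 ^ suc v) ^ suc v * n ^ (2 + (b + v))
cullen-≤ {n} {v} {b} n<2^v n≤b² factorisation = conclude (find-exception (factor-classification n<2^v n≤b²) factors)
  where
  open CullenFactors factorisation
  M = n * 2 ^ n
  K = 2 + (b + v)
  bound : ∀ {D} → Pointwise (λ p m → NonZero m × (p ∈ suc D ∷ powersOfTwo+1 v ⊎ p ≤ m ^ K)) primes cofactors →
    suc M ≤ suc D * (2 ^ suc v) ^ suc v * n ^ K
  bound {D} pw = begin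
    suc M             ≡⟨ product-primes ⟨
    product primes
      ≤⟨ product-≤-exceptions {K = K} primes-unique (_ ∷ applyUpTo⁺₁ (λ t → suc (2 ^ t)) (suc v) (λ _ → _)) pw ⟩
    suc D * product (powersOfTwo+1 v) * product cofactors ^ K
      ≤⟨ *-mono-≤ (*-monoʳ-≤ (suc D) fermat-bound) (^-monoˡ-≤ K (∣⇒≤ product-cofactors)) ⟩
    suc D * (2 ^ suc v) ^ suc v * n ^ K ∎
    where
    open ≤-Reasoning
    fermat≤ : ∀ {t} → t < suc v → suc (2 ^ t) ≤ 2 ^ suc v
    fermat≤ {t} (s≤s t≤v) = ≤-trans (+-mono-≤ (m^n>0 2 v) (^-monoʳ-≤ 2 t≤v)) (≤-reflexive (2^n+2^n v))
    fermat-bound : product (powersOfTwo+1 v) ≤ (2 ^ suc v) ^ suc v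
    fermat-bound = subst (λ l → product (powersOfTwo+1 v) ≤ (2 ^ suc v) ^ l)
      (length-applyUpTo (λ t → suc (2 ^ t)) (suc v))
      (product-≤-^ (applyUpTo⁺₁ (λ t → suc (2 ^ t)) (suc v) fermat≤))

  Bounded : ℕ → ℕ → Set
  Bounded p m = NonZero m × ((∃[ t ] t < suc v × p ≡ suc (2 ^ t)) ⊎ p ≤ m ^ K)

  weaken : ∀ {D p m} → Bounded p m → NonZero m × (p ∈ suc D ∷ powersOfTwo+1 v ⊎ p ≤ m ^ K)
  weaken (m≢0 , inj₁ (t , t<1+v , refl)) = m≢0 , inj₁ (there (∈-applyUpTo⁺ (λ t → suc (2 ^ t)) t<1+v))
  weaken (m≢0 , inj₂ p≤m^K) = m≢0 , inj₂ p≤m^K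

  conclude : Pointwise Bounded primes cofactors ⊎ (∃₂ λ p m → CullenFactor n p m × PowerRoot M p) →
    ∃[ D ] D ^ 3 ≤ M × suc M ≤ suc D * (2 ^ suc v) ^ suc v * n ^ K
  -- Without an exceptional prime, D = 0 contributes the harmless factor 1.
  conclude (inj₁ bounded) = 0 , z≤n , bound (Pointwise.map (weaken {0}) bounded)
  conclude (inj₂ (p , m , factor , p-prime , D , i , refl , i-odd , D^i≡M)) =
    D , proper-root-cube≤ {{D≢0 D p-prime}} i-odd D^i≡M (s≤s⁻¹ p<C) , bound (Pointwise.map only factors)
    where
    open CullenFactor factor using (p<C)
    D≢0 : ∀ D → Prime (suc D) → NonZero D
    D≢0 zero p = contradiction p ¬prime[1]
    D≢0 (suc _) _ = _
    only : ∀ {p′ m′} → CullenFactor n p′ m′ → NonZero m′ × (p′ ∈ suc D ∷ powersOfTwo+1 v ⊎ p′ ≤ m′ ^ K)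
    only factor′ with factor-classification {b = b} n<2^v n≤b² factor′
    ... | inj₂ bounded = weaken {D} bounded
    -- Any prime of the exceptional kind coincides with `p`, by `prime-root-unique`.
    ... | inj₁ (p′-prime , D′ , j , refl , j-odd , D′^j≡M) =
      nonZero-∣ (CullenFactor.m∣n factor′) ,
      inj₁ (here (cong suc (prime-root-unique p′-prime p-prime j-odd i-odd (trans D′^j≡M (sym D^i≡M)))))

-- Contradiction for n ≥ 1024

bracket : ∀ (f : ℕ → ℕ) {n} k → f 0 ≤ n → n < f k → ∃[ i ] f i ≤ n × n < f (suc i)
bracket f zero f0≤n n<f0 = contradiction f0≤n (<⇒≱ n<f0)
bracket f {n} (suc k) f0≤n n<f[1+k] with f k ≤? n
... | yes fk≤n = k , fk≤n , n<f[1+k]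
... | no fk≰n = bracket f k f0≤n (≰⇒> fk≰n)

n<2^n : ∀ n → n < 2 ^ n
n<2^n zero = s≤s z≤n
n<2^n (suc n) = ≤-trans (+-mono-≤ (m^n>0 2 n) (n<2^n n)) (≤-reflexive (2^n+2^n n))

9[12+j]²≤2^[11+j] : ∀ j → 9 * ((12 + j) * (12 + j)) ≤ 2 ^ (11 + j)
9[12+j]²≤2^[11+j] zero = ≤ᵇ⇒≤ (9 * (12 * 12)) (2 ^ 11) _
9[12+j]²≤2^[11+j] (suc j) = begin
  -- With x = 12 + j the added term is 9 (2 x^2 - (x + 1)^2).
  9 * ((12 + suc j) * (12 + suc j))  ≤⟨ m≤m+n _ (9 * (119 + 22 * j + j * j)) ⟩
  9 * ((12 + suc j) * (12 + suc j)) + 9 * (119 + 22 * j + j * j) ≡⟨ lem j ⟩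
  2 * (9 * ((12 + j) * (12 + j))) ≤⟨ *-monoʳ-≤ 2 (9[12+j]²≤2^[11+j] j) ⟩
  2 * 2 ^ (11 + j) ≡⟨ cong (2 ^_) (+-suc 11 j) ⟨
  2 ^ (11 + suc j) ∎
  where
  open ≤-Reasoning
  lem : ∀ j → 9 * ((12 + suc j) * (12 + suc j)) + 9 * (119 + 22 * j + j * j) ≡ 2 * (9 * ((12 + j) * (12 + j)))
  lem = solve-∀

-- For w ≤ 10 the left side is at most 33. For w ≥ 11, b < 3 (w + 1) would give b^2 ≤ 9 (w + 1)^2 ≤
-- 2^w ≤ n.
3v≤b : ∀ {w b n} → 33 ≤ b → 2 ^ w ≤ n → n < b * b → 3 * suc w ≤ b
3v≤b {w} {b} {n} 33≤b 2^w≤n n<b² with w ≤? 10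
... | yes w≤10 = ≤-trans (*-monoʳ-≤ 3 (s≤s w≤10)) 33≤b
... | no w≰10 = ≮⇒≥ λ b<3v → <⇒≱ n<b² (begin
    b * b                              ≤⟨ *-mono-≤ (<⇒≤ b<3v) (<⇒≤ b<3v) ⟩
    (3 * suc w) * (3 * suc w)          ≡⟨ lem (suc w) ⟩
    9 * (suc w * suc w)                ≡⟨ cong (λ x → 9 * (suc x * suc x)) w≡ ⟩
    9 * ((12 + j) * (12 + j))          ≤⟨ 9[12+j]²≤2^[11+j] j ⟩
    2 ^ (11 + j)                       ≡⟨ cong (2 ^_) w≡ ⟨
    2 ^ w                              ≤⟨ 2^w≤n ⟩
    n ∎)
  where
  open ≤-Reasoning
  j = w ∸ 11
  w≡ : w ≡ 11 + j
  w≡ = sym (m+[n∸m]≡n (≰⇒> w≰10))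
  lem : ∀ x → (3 * x) * (3 * x) ≡ 9 * (x * x)
  lem = solve-∀

-- The left side collects the exponents of 2 bounding the three factors in `cullen-≤`. The first is
-- about n / 3; the other two are quadratic in w and a, and 3 (w + 1) ≤ a + 1 turns them into at
-- most about 5/9 of a^2.
exponent-bound : ∀ {n a w u} → 32 ≤ a → a * a ≤ n → 3 * suc w ≤ suc a → 3 * u ≤ n + suc w + 3 →
  u + (2 + w) * (2 + w) + suc w * (2 + (suc a + suc w)) ≤ n + w
-- The factor 9 lets only 3 u and 3 v appear; the extra 9 matches 9 v = 9 w + 9.
exponent-bound {n} {a} {w} {u} 32≤a a²≤n 3v≤b 3u≤ = *-cancelˡ-≤ 9 (+-cancelʳ-≤ 9 _ _ (begin
  9 * (u + (1 + v) * (1 + v) + v * (2 + (b + v))) + 9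
    ≡⟨ lem₁ u v b ⟩
  3 * (3 * u) + (2 * ((3 * v) * (3 * v)) + 3 * ((3 * v) * b) + 12 * (3 * v) + 18)
    ≤⟨ +-mono-≤ (*-monoʳ-≤ 3 3u≤) (+-monoˡ-≤ 18 (+-mono-≤
        (+-mono-≤ (*-monoʳ-≤ 2 (*-mono-≤ 3v≤b 3v≤b)) (*-monoʳ-≤ 3 (*-monoˡ-≤ b 3v≤b)))
        (*-monoʳ-≤ 12 3v≤b))) ⟩
  3 * (n + v + 3) + (2 * (b * b) + 3 * (b * b) + 12 * b + 18)
    ≡⟨ lem₂ n v a ⟩
  3 * n + 3 * v + (5 * (a * a) + (22 * a + 44))
    ≤⟨ +-monoʳ-≤ (3 * n + 3 * v) (+-monoʳ-≤ (5 * (a * a)) 22a+44≤a²) ⟩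
  3 * n + 3 * v + (5 * (a * a) + a * a)
    ≡⟨ lem₃ n v a ⟩
  3 * n + 3 * v + 6 * (a * a)
    ≤⟨ +-mono-≤ (+-monoʳ-≤ (3 * n) (*-monoˡ-≤ v (≤ᵇ⇒≤ 3 9 _))) (*-monoʳ-≤ 6 a²≤n) ⟩
  3 * n + 9 * v + 6 * n
    ≡⟨ lem₄ n w ⟩
  9 * (n + w) + 9 ∎))
  where
  open ≤-Reasoning
  v = suc w
  b = suc a
  lem₁ : ∀ u v b → 9 * (u + (1 + v) * (1 + v) + v * (2 + (b + v))) + 9 ≡
    3 * (3 * u) + (2 * ((3 * v) * (3 * v)) + 3 * ((3 * v) * b) + 12 * (3 * v) + 18)
  lem₁ = solve-∀
  lem₂ : ∀ n v a → 3 * (n + v + 3) + (2 * (suc a * suc a) + 3 * (suc a * suc a) + 12 * suc a + 18) ≡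
    3 * n + 3 * v + (5 * (a * a) + (22 * a + 44))
  lem₂ = solve-∀
  lem₃ : ∀ n v a → 3 * n + 3 * v + (5 * (a * a) + a * a) ≡ 3 * n + 3 * v + 6 * (a * a)
  lem₃ = solve-∀
  lem₄ : ∀ n w → 3 * n + 9 * suc w + 6 * n ≡ 9 * (n + w) + 9
  lem₄ = solve-∀
  22a+44≤a² : 22 * a + 44 ≤ a * a
  22a+44≤a² = begin
    22 * a + 44          ≤⟨ +-monoʳ-≤ (22 * a) (≤-trans (≤ᵇ⇒≤ 44 320 _) (*-monoʳ-≤ 10 32≤a)) ⟩
    22 * a + 10 * a      ≡⟨ *-distribʳ-+ a 22 10 ⟨
    32 * a               ≤⟨ *-monoˡ-≤ a 32≤a ⟩
    a * a ∎

-- `u` is the least integer with 3 u > n + v, so 2^(3u) exceeds the bound 2^(n+v) for M.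
cube-root-bound : ∀ {D n v} → n < 2 ^ v → D ^ 3 ≤ n * 2 ^ n → ∃[ u ] 3 * u ≤ n + v + 3 × suc D ≤ 2 ^ u
cube-root-bound {D} {n} {v} n<2^v D³≤M = u , 3u≤ , ≰⇒> λ 2^u≤D → <⇒≱ D³<2^3u (begin
    2 ^ (3 * u)   ≡⟨ cong (2 ^_) (*-comm 3 u) ⟩
    2 ^ (u * 3)   ≡⟨ ^-*-assoc 2 u 3 ⟨
    (2 ^ u) ^ 3   ≤⟨ ^-monoˡ-≤ 3 2^u≤D ⟩
    D ^ 3 ∎)
  where
  open ≤-Reasoning
  u = suc ((n + v) / 3)
  3u≤ : 3 * u ≤ n + v + 3
  3u≤ = begin
    3 * u                    ≡⟨ *-suc 3 ((n + v) / 3) ⟩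
    3 + 3 * ((n + v) / 3)    ≡⟨ cong (3 +_) (*-comm 3 ((n + v) / 3)) ⟩
    3 + (n + v) / 3 * 3      ≤⟨ +-monoʳ-≤ 3 (m/n*n≤m (n + v) 3) ⟩
    3 + (n + v)              ≡⟨ +-comm 3 (n + v) ⟩
    n + v + 3 ∎
  n+v<3u : n + v < 3 * u
  n+v<3u = begin-strict
    n + v                            ≡⟨ m≡m%n+[m/n]*n (n + v) 3 ⟩
    (n + v) % 3 + (n + v) / 3 * 3    <⟨ +-monoˡ-< ((n + v) / 3 * 3) (m%n<n (n + v) 3) ⟩
    3 + (n + v) / 3 * 3              ≡⟨ *-comm 3 u ⟨
    3 * u ∎
  D³<2^3u : D ^ 3 < 2 ^ (3 * u)
  D³<2^3u = begin-strict
    D ^ 3              ≤⟨ D³≤M ⟩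
    n * 2 ^ n          ≤⟨ *-monoˡ-≤ (2 ^ n) (<⇒≤ n<2^v) ⟩
    2 ^ v * 2 ^ n      ≡⟨ ^-distribˡ-+-* 2 v n ⟨
    2 ^ (v + n)        ≡⟨ cong (2 ^_) (+-comm v n) ⟩
    2 ^ (n + v)        <⟨ ^-monoʳ-< 2 (s≤s (s≤s z≤n)) n+v<3u ⟩
    2 ^ (3 * u) ∎

¬cullen-factors-large : ∀ {n} → 1024 ≤ n → ¬ CullenFactors n
¬cullen-factors-large {n@(suc _)} 1024≤n factorisation
  -- `w` and `a` are the logarithm to base 2 and the square root of n, rounded down. The bound for C
  -- then becomes at most 2^(n+w) ≤ n 2^n < C.
  with bracket (2 ^_) n (≤-trans (s≤s z≤n) 1024≤n) (n<2^n n)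
     | bracket (λ a → a * a) (suc n) z≤n (m≤m*n (suc n) (suc n))
... | w , 2^w≤n , n<2^v | a , a²≤n , n<b²
  with cullen-≤ {n} {suc w} {suc a} n<2^v (<⇒≤ n<b²) factorisation
... | D , D³≤M , C≤ with cube-root-bound {D} n<2^v D³≤M
... | u , 3u≤ , 1+D≤2^u = <⇒≱ C≤ (begin
    suc D * (2 ^ suc v) ^ suc v * n ^ K
      ≤⟨ *-mono-≤ (*-monoˡ-≤ ((2 ^ suc v) ^ suc v) 1+D≤2^u) (^-monoˡ-≤ K (<⇒≤ n<2^v)) ⟩
    2 ^ u * (2 ^ suc v) ^ suc v * (2 ^ v) ^ K
      ≡⟨ cong₂ (λ x y → 2 ^ u * x * y) (^-*-assoc 2 (suc v) (suc v)) (^-*-assoc 2 v K) ⟩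
    2 ^ u * 2 ^ (suc v * suc v) * 2 ^ (v * K)
      ≡⟨ cong (_* 2 ^ (v * K)) (^-distribˡ-+-* 2 u (suc v * suc v)) ⟨
    2 ^ (u + suc v * suc v) * 2 ^ (v * K)
      ≡⟨ ^-distribˡ-+-* 2 (u + suc v * suc v) (v * K) ⟨
    2 ^ (u + suc v * suc v + v * K)
      ≤⟨ ^-monoʳ-≤ 2 (exponent-bound {u = u} 32≤a a²≤n (3v≤b (s≤s 32≤a) 2^w≤n n<b²) 3u≤) ⟩
    2 ^ (n + w)        ≡⟨ cong (2 ^_) (+-comm n w) ⟩
    2 ^ (w + n)        ≡⟨ ^-distribˡ-+-* 2 w n ⟩
    2 ^ w * 2 ^ n      ≤⟨ *-monoˡ-≤ (2 ^ n) 2^w≤n ⟩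
    n * 2 ^ n ∎)
  where
  open ≤-Reasoning
  v = suc w
  K = 2 + (suc a + v)
  -- The threshold is 1024 = 32^2.
  32≤a : 32 ≤ a
  32≤a = ≮⇒≥ λ a<32 → <⇒≱ n<b² (≤-trans (*-mono-≤ a<32 a<32) 1024≤n)

-- Enumeration for n < 1024

divisorsUpTo : ℕ → ℕ → List ℕ
divisorsUpTo n zero = []
divisorsUpTo n (suc k) with n % suc k
... | zero = suc k ∷ divisorsUpTo n k
... | suc _ = divisorsUpTo n k

∈-divisorsUpTo : ∀ {n m} k .{{_ : NonZero m}} → m ∣ n → m ≤ k → m ∈ divisorsUpTo n k
∈-divisorsUpTo {m = suc _} zero _ ()
∈-divisorsUpTo {n} (suc k) m∣n m≤1+k with n % suc k in eq | m≤n⇒m<n∨m≡n m≤1+k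
... | zero | inj₁ (s≤s m≤k) = there (∈-divisorsUpTo k m∣n m≤k)
... | zero | inj₂ refl = here refl
... | suc _ | inj₁ (s≤s m≤k) = ∈-divisorsUpTo k m∣n m≤k
... | suc _ | inj₂ refl with () ← trans (sym eq) (n∣m⇒m%n≡0 n (suc k) m∣n)

-- Started at D = m, this meets every m 2^t + 1 with t < k, doubling D instead of recomputing the
-- power.
shiftedDoublings : ℕ → ℕ → ℕ → List ℕ
shiftedDoublings N zero D = []
shiftedDoublings N (suc k) D with N % suc D
... | zero = suc D ∷ shiftedDoublings N k (2 * D)
... | suc _ = shiftedDoublings N k (2 * D)

2*-shift : ∀ d x → suc (d * (2 * x)) ≡ suc (2 * d * x)
2*-shift = solve-∀

∈-shiftedDoublings : ∀ {N t} k D → suc (D * 2 ^ t) ∣ N → t < k → suc (D * 2 ^ t) ∈ shiftedDoublings N k D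
∈-shiftedDoublings {N} {zero} (suc k) D p∣N _ with N % suc D in eq
... | zero = here (cong suc (*-identityʳ D))
... | suc _ with () ← trans (sym eq) (n∣m⇒m%n≡0 N (suc D) (subst (λ x → suc x ∣ N) (*-identityʳ D) p∣N))
∈-shiftedDoublings {N} {suc t} (suc k) D p∣N (s≤s t<k) with N % suc D
... | zero = there (subst (_∈ shiftedDoublings N k (2 * D)) (sym (2*-shift D (2 ^ t)))
      (∈-shiftedDoublings k (2 * D) (subst (_∣ N) (2*-shift D (2 ^ t)) p∣N) t<k))
... | suc _ = subst (_∈ shiftedDoublings N k (2 * D)) (sym (2*-shift D (2 ^ t)))
      (∈-shiftedDoublings k (2 * D) (subst (_∣ N) (2*-shift D (2 ^ t)) p∣N) t<k)

shiftedDoublings-nonZero : ∀ {N} k D → All NonZero (shiftedDoublings N k D)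
shiftedDoublings-nonZero zero D = []
shiftedDoublings-nonZero {N} (suc k) D with N % suc D
... | zero = _ ∷ shiftedDoublings-nonZero k (2 * D)
... | suc _ = shiftedDoublings-nonZero k (2 * D)

-- The bound `suc n` admits t = n. The filter drops C itself, which arises from m = t = n, and
-- deduplication keeps a number that comes from several pairs (m, t) from being counted repeatedly.
candidates : ℕ → ℕ → List ℕ
candidates n N = deduplicate _≟_ (filter (_<? N) (concatMap (shiftedDoublings N (suc n)) (divisorsUpTo n n)))

productOfCandidates<ᵇ : ℕ → ℕ → Bool
productOfCandidates<ᵇ n N = product (candidates n N) <ᵇ N

checkUpTo : ℕ → Bool
checkUpTo zero = true
checkUpTo (suc n) = productOfCandidates<ᵇ (suc n) (cullen (suc n)) ∧ checkUpTo n

checkUpTo-sound : ∀ k → checkUpTo k ≡ true → ∀ {n} .{{_ : NonZero n}} → n ≤ k →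
  product (candidates n (suc (n * 2 ^ n))) < suc (n * 2 ^ n)
checkUpTo-sound zero _ {suc _} ()
checkUpTo-sound (suc k) checked n≤1+k with m≤n⇒m<n∨m≡n n≤1+k
... | inj₁ (s≤s n≤k) = checkUpTo-sound k (∧-conicalʳ (productOfCandidates<ᵇ (suc k) (cullen (suc k))) _ checked) n≤k
... | inj₂ refl = subst (λ N → product (candidates (suc k) N) < N) (+-comm (suc k * 2 ^ suc k) 1)
      (<ᵇ⇒< (product (candidates (suc k) (cullen (suc k)))) (cullen (suc k))
        (Equivalence.from T-≡ (∧-conicalˡ _ (checkUpTo k) checked)))

cullenFactor⇒∈-candidates : ∀ {n p m} .{{_ : NonZero n}} → CullenFactor n p m → p ∈ candidates n (suc (n * 2 ^ n))
cullenFactor⇒∈-candidates {n} {p} {m} record { p∣C = p∣C; p<C = p<C; m∣n = m∣n; t≤n = t≤n; p≡ = refl } =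
  ∈-deduplicate⁺ _≟_ (∈-filter⁺ (_<? suc (n * 2 ^ n)) (∈-concatMap⁺ _ (Any.map
    (λ { refl → ∈-shiftedDoublings (suc n) m p∣C (s≤s t≤n) })
    (∈-divisorsUpTo n {{nonZero-∣ m∣n}} m∣n (∣⇒≤ m∣n)))) p<C)

-- The product of all numbers m 2^t + 1 < C with m ∣ n and t ≤ n that divide C is already less than C.
checked : checkUpTo 1023 ≡ true
checked = refl

-- The primes are distinct and all occur among the candidates, so C is at most the product of the
-- candidates, contrary to the check.
¬cullen-factors-small : ∀ {n} .{{_ : NonZero n}} → n < 1024 → ¬ CullenFactors n
¬cullen-factors-small {n} (s≤s n≤1023) factorisation = <⇒≱ (checkUpTo-sound 1023 checked n≤1023) (begin
    suc (n * 2 ^ n)      ≡⟨ product-primes ⟨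
    product primes       ≤⟨ unique-⊆⇒product-≤ primes-unique (∈-candidates factors) (All.tabulate positive) ⟩
    product (candidates n (suc (n * 2 ^ n))) ∎)
  where
  open ≤-Reasoning
  open CullenFactors factorisation
  ∈-candidates : ∀ {ps ms} → Pointwise (CullenFactor n) ps ms → ∀ {p} → p ∈ ps → p ∈ candidates n (suc (n * 2 ^ n))
  ∈-candidates (factor ∷ _) (here refl) = cullenFactor⇒∈-candidates factor
  ∈-candidates (_ ∷ factors) (there p∈ps) = ∈-candidates factors p∈ps
  positive : ∀ {x} → x ∈ candidates n (suc (n * 2 ^ n)) → NonZero x
  positive x∈ with Any.satisfied (∈-concatMap⁻ _ {xs = divisorsUpTo n n}
    (proj₁ (∈-filter⁻ (_<? suc (n * 2 ^ n)) (∈-deduplicate⁻ _≟_ _ x∈))))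
  ... | m , x∈doublings = All.lookup (shiftedDoublings-nonZero {suc (n * 2 ^ n)} (suc n) m) x∈doublings

theorem1 : ∀ (n : ℕ) → n ≥ 1 → φ (cullen n) ∣ cullen n ∸ 1 → Prime (cullen n)
theorem1 n@(suc _) _ φ∣C-1 with prime? (suc (n * 2 ^ n))
... | yes C-prime = subst Prime (+-comm 1 (n * 2 ^ n)) C-prime
... | no ¬C-prime = contradiction (cullen-factors n ¬C-prime φ∣M) ¬factors
  where
  φ∣M : φ (suc (n * 2 ^ n)) ∣ n * 2 ^ n
  φ∣M = subst₂ (λ x y → φ x ∣ y) (+-comm (n * 2 ^ n) 1) (m+n∸n≡m (n * 2 ^ n) 1) φ∣C-1
  ¬factors : ¬ CullenFactors n
  ¬factors with n <? 1024
  ... | yes n<1024 = ¬cullen-factors-small n<1024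
  ... | no n≮1024 = ¬cullen-factors-large (≮⇒≥ n≮1024)
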